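{- $gr^3_2(B_6)=11$.
   Context: $K_n$ is the complete graph of order $n$. The book $B_n:=K_2+nK_1$ (graph join) is the graph on $n+2$ vertices consisting of an edge $xy$ (the spine) together with $n$ further, pairwise non-adjacent vertices (the pages), each adjacent to both $x$ and $y$. A $t$-coloring of $K_p$ is a map $f:E(K_p)\to\{1,\dots,t\}$, not assumed surjective. A Gallai $t$-coloring is a $t$-coloring with no rainbow triangle, i.e. there are no three vertices $x,y,z$ such that $f(xy),f(xz),f(yz)$ are pairwise distinct. For $1\le s<t$ and a graph $G$, the weakened Gallai-Ramsey number $gr^t_s(G)$ is the least $p\in\mathbb{N}$ such that every Gallai $t$-coloring of $K_p$ contains a (not necessarily induced) subgraph isomorphic to $G$ whose edges use at most $s$ colors. -}

module Defs where

open import Data.Fin using (Fin)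
open import Data.Fin.Subset using (Subset; _∈_; ∣_∣)
open import Data.Nat using (ℕ; _≤_)
open import Data.Product using (Σ-syntax; _×_; _,_)
open import Data.Sum using (_⊎_; inj₁; inj₂)
open import Data.Unit using (⊤; tt)
open import Function.Definitions using (Injective)
open import Relation.Binary.Definitions using (Symmetric; Irreflexive)
open import Relation.Binary.PropositionalEquality
  using (_≡_; _≢_; refl; sym; ≢-sym)
open import Relation.Nullary using (¬_)

record Graph : Set₁ where
  field
    V      : Set
    Adj    : V → V → Set
    symm   : Symmetric Adj
    irrefl : Irreflexive _≡_ Adj

open Graph public

K : ℕ → Graph
K n = record
  { V      = Fin n
  ; Adj    = _≢_
  ; symm   = ≢-sym
  ; irrefl = λ i≡j i≢j → i≢j i≡j
  }

-- The disjoint union of n copies of G, written nG on paper.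
infixr 7 _·_
_·_ : ℕ → Graph → Graph
n · G = record
  { V      = Fin n × V G
  ; Adj    = λ (i , u) (j , v) → i ≡ j × Adj G u v
  ; symm   = λ (i≡j , uv) → sym i≡j , symm G uv
  ; irrefl = λ { refl (_ , uu) → irrefl G refl uu }
  }

-- The graph join, written G + H on paper.
infixl 6 _⋈_
_⋈_ : Graph → Graph → Graph
G ⋈ H = record
  { V      = V G ⊎ V H
  ; Adj    = adj
  ; symm   = λ {u} {v} → adj-sym u v
  ; irrefl = λ {u} → adj-irrefl u
  }
  where
  adj : V G ⊎ V H → V G ⊎ V H → Set
  adj (inj₁ u) (inj₁ v) = Adj G u v
  adj (inj₁ _) (inj₂ _) = ⊤
  adj (inj₂ _) (inj₁ _) = ⊤
  adj (inj₂ u) (inj₂ v) = Adj H u v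

  adj-sym : ∀ u v → adj u v → adj v u
  adj-sym (inj₁ _) (inj₁ _) = symm G
  adj-sym (inj₁ _) (inj₂ _) = λ _ → tt
  adj-sym (inj₂ _) (inj₁ _) = λ _ → tt
  adj-sym (inj₂ _) (inj₂ _) = symm H

  adj-irrefl : ∀ u {v} → u ≡ v → ¬ adj u v
  adj-irrefl (inj₁ _) refl = irrefl G refl
  adj-irrefl (inj₂ _) refl = irrefl H refl

B : ℕ → Graph
B n = K 2 ⋈ n · K 1

-- A t-coloring of the edges of K p, as a symmetric function of the two
-- endpoints.  Its values on the diagonal are junk: no definition below
-- depends on them.
record Coloring (t p : ℕ) : Set where
  field
    color     : Fin p → Fin p → Fin t
    color-sym : ∀ x y → color x y ≡ color y x

open Coloring public

RainbowTriangle : ∀ {t p} → Coloring t p → Set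
RainbowTriangle {p = p} f =
  Σ[ x ∈ Fin p ] Σ[ y ∈ Fin p ] Σ[ z ∈ Fin p ]
    (x ≢ y × x ≢ z × y ≢ z) ×
    (color f x y ≢ color f x z ×
     color f x y ≢ color f y z ×
     color f x z ≢ color f y z)

Gallai : ∀ {t p} → Coloring t p → Set
Gallai f = ¬ RainbowTriangle f

-- A not necessarily induced subgraph of H isomorphic to G, given by the
-- embedding of G onto it.
record Copy (G H : Graph) : Set where
  field
    embed     : V G → V H
    injective : Injective _≡_ _≡_ embed
    preserves : ∀ {u v} → Adj G u v → Adj H (embed u) (embed v)

open Copy public

-- The edges of the copy have all their colors in some set of at most s colors.
UsesAtMost : ∀ {t p G} → ℕ → Coloring t p → Copy G (K p) → Set
UsesAtMost {t} {G = G} s f φ =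
  Σ[ S ∈ Subset t ]
    ∣ S ∣ ≤ s ×
    (∀ {u v} → Adj G u v → color f (embed φ u) (embed φ v) ∈ S)

Forces : (t s : ℕ) → Graph → ℕ → Set
Forces t s G p =
  (f : Coloring t p) → Gallai f →
  Σ[ φ ∈ Copy G (K p) ] UsesAtMost s f φ

IsLeast : (ℕ → Set) → ℕ → Set
IsLeast P p = P p × (∀ q → P q → p ≤ q)

-- The relation "gr^t_s(G) = p", meant for 1 ≤ s < t.
IsWeakenedGallaiRamsey : (t s : ℕ) → Graph → ℕ → Set
IsWeakenedGallaiRamsey t s G p = IsLeast (Forces t s G) p

{-# OPTIONS --safe #-}
module Submission where

-- Lower bound: color two disjoint K₅'s with two pentagons each, in colors 0
-- and 1, and all edges between them with color 2.
--
-- Upper bound: let d_c(v) be the number of edges of color c at v, and suppose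
-- that no edge of K₁₁ has six pages avoiding a color other than its own.  For
-- an edge vx of color i this gives d_i(v) + d_j(v) ≤ 6 + #{z : vz = i, xz = k}.
-- If moreover vy = j and xy = i, then {z : vz = j, yz = k} ∪ {y} is contained
-- in {z : vz = j, xz = i}, hence d_i(v) + d_j(v) ≤ 5 + #{z : vz = j, xz = i}.
-- Combining these bounds at v and at x yields d_k(v) ≥ 4.  So a vertex with two
-- colors has three, each at least four times, which exceeds the degree 10.
-- Hence every vertex sees one color only, contradicting the first bound.

open import Defs

open import Data.Bool using (if_then_else_)
open import Data.Empty using (⊥; ⊥-elim)
open import Data.Fin using (Fin; zero; suc; toℕ; inject≤; punchIn; punchOut; remQuot; _≟_)
open import Data.Fin.Patterns using (0F; 1F; 2F)
open import Data.Fin.Properties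
  using (all?; any?; suc-injective; inject≤-injective; punchOut-injective; punchIn-punchOut)
open import Data.Fin.Subset using (Subset; inside; outside; _∈_; _∉_; ∣_∣; ∁; ⁅_⁆)
open import Data.Fin.Subset.Properties using (x∉p⇒x∈∁p; x≢y⇒x∉⁅y⁆; ∣⁅x⁆∣≡1; ∣∁p∣≡n∸∣p∣)
open import Data.Nat
  using (ℕ; zero; suc; pred; _+_; _*_; _∸_; _≤_; _<_; _<?_; z≤n; s≤s; s≤s⁻¹; ∣_-_∣)
open import Data.Nat.Properties hiding (_≟_; suc-injective)
open import Data.Nat.Tactic.RingSolver using (solve-∀)
open import Data.Product using (Σ-syntax; ∃-syntax; _×_; _,_; proj₁; proj₂)
open import Data.Sum using (_⊎_; inj₁; inj₂; [_,_]′)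
open import Data.Unit using (tt)
open import Data.Vec using ([]; _∷_; there)
open import Data.Vec.Functional using (removeAt)
open import Algebra.Properties.Semiring.Sum +-*-semiring
  using (sum; sum-cong-≗; sum-replicate-zero; sum-remove; ∑-distrib-+)
open import Function using (_∘_; id)
open import Function.Definitions using (Injective)
open import Relation.Binary.PropositionalEquality
open import Relation.Nullary using (Dec; yes; no; does; ¬_; contradiction)
open import Relation.Nullary.Decidable
  using (from-yes; ¬?; _×-dec_; _⊎-dec_; _→-dec_; dec-true; dec-false)

-- Indicators and sums over finite sets.

𝟙 : ∀ {P : Set} → Dec P → ℕ
𝟙 P? = if does P? then 1 else 0

𝟙-yes : ∀ {P : Set} (P? : Dec P) → P → 𝟙 P? ≡ 1
𝟙-yes P? p rewrite dec-true P? p = refl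

𝟙-no : ∀ {P : Set} (P? : Dec P) → ¬ P → 𝟙 P? ≡ 0
𝟙-no P? ¬p rewrite dec-false P? ¬p = refl

𝟙-pos : ∀ {P : Set} (P? : Dec P) → 0 < 𝟙 P? → P
𝟙-pos (yes p) _ = p

𝟙≤1 : ∀ {P : Set} (P? : Dec P) → 𝟙 P? ≤ 1
𝟙≤1 (yes _) = ≤-refl
𝟙≤1 (no _)  = z≤n

≤𝟙 : ∀ {P : Set} (P? : Dec P) {m} → m ≤ 1 → (0 < m → P) → m ≤ 𝟙 P?
≤𝟙 (yes _)  m≤1 _ = m≤1
≤𝟙 (no ¬p) {zero}  _ _ = z≤n
≤𝟙 (no ¬p) {suc m} _ f = contradiction (f (s≤s z≤n)) ¬p

𝟙-*-monoʳ-≤ : ∀ {P : Set} (P? : Dec P) {m n} → (P → m ≤ n) → 𝟙 P? * m ≤ 𝟙 P? * n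
𝟙-*-monoʳ-≤ (yes p) m≤n = +-monoˡ-≤ 0 (m≤n p)
𝟙-*-monoʳ-≤ (no _)  _   = z≤n

+-pos : ∀ m {n} → 0 < m + n → 0 < m ⊎ 0 < n
+-pos zero    n>0 = inj₂ n>0
+-pos (suc m) _   = inj₁ (s≤s z≤n)

*-pos : ∀ m n → 0 < m * n → 0 < m × 0 < n
*-pos (suc m) (suc n) _ = s≤s z≤n , s≤s z≤n
*-pos (suc m) zero    q rewrite *-zeroʳ m = contradiction q λ()

sum-mono-≤ : ∀ {n} {g h : Fin n → ℕ} → (∀ z → g z ≤ h z) → sum g ≤ sum h
sum-mono-≤ {zero}  g≤h = z≤n
sum-mono-≤ {suc n} g≤h = +-mono-≤ (g≤h zero) (sum-mono-≤ (g≤h ∘ suc))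

sum-pos : ∀ {n} (h : Fin n → ℕ) → 0 < sum h → ∃[ z ] 0 < h z
sum-pos {suc n} h q with +-pos (h zero) q
... | inj₁ h₀>0 = zero , h₀>0
... | inj₂ t>0 with z , hz>0 ← sum-pos (h ∘ suc) t>0 = suc z , hz>0

sum-ones : ∀ n → sum {n} (λ _ → 1) ≡ n
sum-ones zero    = refl
sum-ones (suc n) = cong suc (sum-ones n)

sum-δ : ∀ {n} (h : Fin n → ℕ) x → sum (λ z → h z * 𝟙 (x ≟ z)) ≡ h x
sum-δ {suc n} h zero = begin
  h zero * 1 + sum (λ z → h (suc z) * 0)
    ≡⟨ cong₂ _+_ (*-identityʳ _) (sum-cong-≗ λ z → *-zeroʳ (h (suc z))) ⟩
  h zero + sum {n} (λ _ → 0)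
    ≡⟨ cong (h zero +_) (sum-replicate-zero n) ⟩
  h zero + 0
    ≡⟨ +-identityʳ _ ⟩
  h zero ∎
  where open ≡-Reasoning
sum-δ {suc n} h (suc x) = cong₂ _+_ (*-zeroʳ (h zero)) (sum-δ (h ∘ suc) x)

-- As `h` takes only the values 0 and 1, `sum h` counts its support, and scanning the indices finds
-- the first `m` elements of it. This turns a page count into the page vertices of an embedding.
injection-into-support : ∀ {n} m (h : Fin n → ℕ) → (∀ z → h z ≤ 1) → m ≤ sum h →
  Σ[ φ ∈ (Fin m → Fin n) ] Injective _≡_ _≡_ φ × (∀ a → 0 < h (φ a))
injection-into-support zero h h≤1 m≤ = (λ ()) , (λ { {()} }) , λ ()
injection-into-support {suc n} (suc m) h h≤1 m≤ with h zero in h₀ | h≤1 zero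
... | zero | _ with φ , inj , pos ← injection-into-support (suc m) (h ∘ suc) (h≤1 ∘ suc) m≤
  = suc ∘ φ , inj ∘ suc-injective , pos
... | suc zero | _ with φ , inj , pos ← injection-into-support m (h ∘ suc) (h≤1 ∘ suc) (s≤s⁻¹ m≤)
  = (λ { zero → zero ; (suc a) → suc (φ a) })
  , (λ { {zero} {zero} _ → refl ; {suc _} {suc _} eq → cong suc (inj (suc-injective eq)) })
  , λ { zero → subst (0 <_) (sym h₀) (s≤s z≤n) ; (suc a) → pos a }
... | suc (suc _) | s≤s ()

-- Induction on `m`: the index `φ zero` contributes at least 1 and, `φ` being injective, removing it
-- keeps all other values of `φ`.
support-bounds-injection : ∀ {n} m (h : Fin n → ℕ) (φ : Fin m → Fin n) →
  Injective _≡_ _≡_ φ → (∀ a → 0 < h (φ a)) → m ≤ sum h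
support-bounds-injection zero h φ inj pos = z≤n
support-bounds-injection {zero} (suc m) h φ inj pos with () ← φ zero
support-bounds-injection {suc n} (suc m) h φ inj pos = begin
  1 + m                                    ≤⟨ +-mono-≤ (pos zero) rest ⟩
  h (φ zero) + sum (removeAt h (φ zero))   ≡⟨ sum-remove h ⟨
  sum h                                    ∎
  where
  open ≤-Reasoning
  ≢φ : ∀ a → φ zero ≢ φ (suc a)
  ≢φ a eq with () ← inj eq
  rest : m ≤ sum (removeAt h (φ zero))
  rest = support-bounds-injection m (removeAt h (φ zero)) (λ a → punchOut (≢φ a))
    (λ {a} {b} eq → suc-injective (inj (punchOut-injective (≢φ a) (≢φ b) eq)))
    (λ a → subst (λ z → 0 < h z) (sym (punchIn-punchOut (≢φ a))) (pos (suc a)))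

∑-distrib-+₃ : ∀ {n} (g h l : Fin n → ℕ) →
  sum (λ z → g z + (h z + l z)) ≡ sum g + (sum h + sum l)
∑-distrib-+₃ g h l = trans (∑-distrib-+ g (λ z → h z + l z)) (cong (sum g +_) (∑-distrib-+ h l))

-- Books as page counts.

module Books {p} (f : Coloring 3 p) where

  Page : Fin 3 → Fin p → Fin p → Fin p → Set
  Page c x y z = x ≢ z × y ≢ z × color f x z ≢ c × color f y z ≢ c

  page? : ∀ c x y z → Dec (Page c x y z)
  page? c x y z =
    ¬? (x ≟ z) ×-dec ¬? (y ≟ z) ×-dec ¬? (color f x z ≟ c) ×-dec ¬? (color f y z ≟ c)

  -- With three colors, using at most two means avoiding one, here c.
  pages : Fin 3 → Fin p → Fin p → ℕ
  pages c x y = sum λ z → 𝟙 (page? c x y z)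

  pages⇒book : ∀ {n c x y} → x ≢ y → color f x y ≢ c → n ≤ pages c x y →
    Σ[ φ ∈ Copy (B n) (K p) ] UsesAtMost 2 f φ
  pages⇒book {n} {c} {x} {y} x≢y xy≢c n≤
    with φ , φ-inj , φ-pos ← injection-into-support n _ (λ z → 𝟙≤1 (page? c x y z)) n≤
    = copy , ∁ ⁅ c ⁆ , ≤-reflexive (trans (∣∁p∣≡n∸∣p∣ ⁅ c ⁆) (cong (3 ∸_) (∣⁅x⁆∣≡1 c)))
    , λ {u} {v} uv → x∉p⇒x∈∁p (x≢y⇒x∉⁅y⁆ (avoids u v uv))
    where
    isPage : ∀ a → Page c x y (φ a)
    isPage a = 𝟙-pos (page? c x y (φ a)) (φ-pos a)

    emb : V (B n) → Fin p
    emb (inj₁ 0F)      = x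
    emb (inj₁ 1F)      = y
    emb (inj₂ (a , _)) = φ a

    emb-inj : ∀ u v → emb u ≡ emb v → u ≡ v
    emb-inj (inj₁ 0F) (inj₁ 0F) _ = refl
    emb-inj (inj₁ 1F) (inj₁ 1F) _ = refl
    emb-inj (inj₁ 0F) (inj₁ 1F) eq = contradiction eq x≢y
    emb-inj (inj₁ 1F) (inj₁ 0F) eq = contradiction (sym eq) x≢y
    emb-inj (inj₁ 0F) (inj₂ (a , _)) eq = contradiction eq (proj₁ (isPage a))
    emb-inj (inj₁ 1F) (inj₂ (a , _)) eq = contradiction eq (proj₁ (proj₂ (isPage a)))
    emb-inj (inj₂ (a , _)) (inj₁ 0F) eq = contradiction (sym eq) (proj₁ (isPage a))
    emb-inj (inj₂ (a , _)) (inj₁ 1F) eq = contradiction (sym eq) (proj₁ (proj₂ (isPage a)))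
    emb-inj (inj₂ (a , 0F)) (inj₂ (b , 0F)) eq = cong (λ a → inj₂ (a , 0F)) (φ-inj eq)

    copy : Copy (B n) (K p)
    copy = record
      { embed     = emb
      ; injective = λ {u} {v} → emb-inj u v
      -- Adjacency in `K p` is inequality, so injectivity and the irreflexivity of `B n` suffice.
      ; preserves = λ {u} {v} uv eq → irrefl (B n) (emb-inj u v eq) uv
      }

    avoids : ∀ u v → Adj (B n) u v → color f (emb u) (emb v) ≢ c
    avoids (inj₁ 0F) (inj₁ 0F) uv = contradiction refl uv
    avoids (inj₁ 1F) (inj₁ 1F) uv = contradiction refl uv
    avoids (inj₁ 0F) (inj₁ 1F) _ = xy≢c
    avoids (inj₁ 1F) (inj₁ 0F) _ = xy≢c ∘ trans (color-sym f x y)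
    avoids (inj₁ 0F) (inj₂ (a , _)) _ = proj₁ (proj₂ (proj₂ (isPage a)))
    avoids (inj₁ 1F) (inj₂ (a , _)) _ = proj₂ (proj₂ (proj₂ (isPage a)))
    avoids (inj₂ (a , _)) (inj₁ 0F) _ = proj₁ (proj₂ (proj₂ (isPage a))) ∘ trans (color-sym f x (φ a))
    avoids (inj₂ (a , _)) (inj₁ 1F) _ = proj₂ (proj₂ (proj₂ (isPage a))) ∘ trans (color-sym f y (φ a))
    avoids (inj₂ (a , 0F)) (inj₂ (_ , 0F)) (_ , 0≢0) = contradiction refl 0≢0

  missingColor : (S : Subset 3) → ∣ S ∣ ≤ 2 → ∃[ c ] c ∉ S
  missingColor (outside ∷ _)                        _ = 0F , λ ()
  missingColor (inside ∷ outside ∷ _)               _ = 1F , λ { (there ()) }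
  missingColor (inside ∷ inside ∷ outside ∷ [])     _ = 2F , λ { (there (there ())) }
  missingColor (inside ∷ inside ∷ inside ∷ [])      (s≤s (s≤s ()))

  -- For the lower bound: at most two colors leave a third, `c`, outside `S`, and the pages of the
  -- copy then count towards `pages c x y`.
  book⇒pages : ∀ {n} (φ : Copy (B n) (K p)) → UsesAtMost 2 f φ →
    ∃[ c ] ∃[ x ] ∃[ y ] x ≢ y × color f x y ≢ c × n ≤ pages c x y
  book⇒pages {n} φ (S , ∣S∣≤2 , inS) with c , c∉S ← missingColor S ∣S∣≤2
    = c , x , y , preserves φ {inj₁ 0F} {inj₁ 1F} (λ ()) , avoid {inj₁ 0F} {inj₁ 1F} (λ ())
    , support-bounds-injection n _ page
        (λ { eq → page-inj (injective φ eq) })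
        (λ a → subst (0 <_) (sym (𝟙-yes (page? c x y (page a)) (isPage a))) (s≤s z≤n))
    where
    x = embed φ (inj₁ 0F)
    y = embed φ (inj₁ 1F)
    page = λ a → embed φ (inj₂ (a , 0F))

    page-inj : ∀ {a b : Fin n} → _≡_ {A = V (B n)} (inj₂ (a , 0F)) (inj₂ (b , 0F)) → a ≡ b
    page-inj refl = refl

    avoid : ∀ {u v} → Adj (B n) u v → color f (embed φ u) (embed φ v) ≢ c
    avoid uv eq = c∉S (subst (_∈ S) eq (inS uv))

    isPage : ∀ a → Page c x y (page a)
    isPage a = preserves φ {inj₁ 0F} {inj₂ (a , 0F)} tt , preserves φ {inj₁ 1F} {inj₂ (a , 0F)} tt
             , avoid {inj₁ 0F} {inj₂ (a , 0F)} tt , avoid {inj₁ 1F} {inj₂ (a , 0F)} tt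

  -- Decided by a search over all `c`, `x`, `y`. The upper bound starts from the second alternative.
  book-or-thin : ∀ n → (Σ[ φ ∈ Copy (B (suc n)) (K p) ] UsesAtMost 2 f φ) ⊎
    (∀ c x y → x ≢ y → color f x y ≢ c → pages c x y ≤ n)
  book-or-thin n
    with any? (λ c → any? λ x → any? λ y →
      ¬? (x ≟ y) ×-dec ¬? (color f x y ≟ c) ×-dec (n <? pages c x y))
  ... | yes (_ , _ , _ , x≢y , xy≢c , thick) = inj₁ (pages⇒book x≢y xy≢c thick)
  ... | no ¬thick = inj₂ λ c x y x≢y xy≢c → ≮⇒≥ λ thick → ¬thick (_ , _ , _ , x≢y , xy≢c , thick)

open Books

-- Orderings of the three colors.

Palette : (i j k : Fin 3) → Set
Palette i j k = i ≢ j × i ≢ k × j ≢ k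

palette-complete : ∀ i j k → Palette i j k → ∀ c → c ≡ i ⊎ c ≡ j ⊎ c ≡ k
palette-complete = from-yes (all? {n = 3} λ i → all? λ j → all? λ k →
  (¬? (i ≟ j) ×-dec ¬? (i ≟ k) ×-dec ¬? (j ≟ k)) →-dec
  all? λ c → (c ≟ i) ⊎-dec (c ≟ j) ⊎-dec (c ≟ k))

thirdColor : ∀ i j → i ≢ j → ∃[ k ] Palette i j k
thirdColor = from-yes (all? {n = 3} λ i → all? λ j → ¬? (i ≟ j) →-dec
  any? λ k → ¬? (i ≟ j) ×-dec ¬? (i ≟ k) ×-dec ¬? (j ≟ k))

otherColor : ∀ i → ∃[ j ] i ≢ j
otherColor = from-yes (all? {n = 3} λ i → any? λ j → ¬? (i ≟ j))

-- Degrees and codegrees by color in a Gallai coloring.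

module ColorDegrees {p} (f : Coloring 3 p) (gallai : Gallai f) where

  -- Diagonal colors are junk, hence the conjunct `v ≢ z`. It makes `e` with fixed `c` the adjacency
  -- matrix of color class `c`.
  hasColor? : ∀ v z c → Dec (v ≢ z × color f v z ≡ c)
  hasColor? v z c = ¬? (v ≟ z) ×-dec (color f v z ≟ c)

  e : Fin p → Fin p → Fin 3 → ℕ
  e v z c = 𝟙 (hasColor? v z c)

  ee : Fin p → Fin p → Fin 3 → Fin 3 → Fin p → ℕ
  ee v x c c′ z = e v z c * e x z c′

  -- `codeg` gives the entries of the product of two such adjacency matrices. Opacity keeps both
  -- sums single terms when `p` becomes 11.
  opaque
    deg : Fin p → Fin 3 → ℕ
    deg v c = sum λ z → e v z c

    codeg : Fin p → Fin p → Fin 3 → Fin 3 → ℕ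
    codeg v x c c′ = sum (ee v x c c′)

    codeg-comm : ∀ v x c c′ → codeg v x c c′ ≡ codeg x v c′ c
    codeg-comm v x c c′ = sum-cong-≗ λ z → *-comm (e v z c) (e x z c′)

  noRainbow : ∀ {x y z i j k} → Palette i j k → x ≢ y → x ≢ z → y ≢ z →
    color f x y ≡ i → color f x z ≡ j → color f y z ≡ k → ⊥
  noRainbow ijk x≢y x≢z y≢z refl refl refl = gallai (_ , _ , _ , (x≢y , x≢z , y≢z) , ijk)

  opaque
    unfolding deg codeg

    deg-witness : ∀ {v c} → 0 < deg v c → ∃[ z ] v ≢ z × color f v z ≡ c
    deg-witness {v} {c} q with z , q′ ← sum-pos _ q = z , 𝟙-pos (hasColor? v z c) q′

  -- The diagonal term completes the three color neighborhoods of `v` to a partition of all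
  -- vertices. Summed over `z`, alone or weighted by another indicator, this gives the degree
  -- identities.
  e-total : ∀ {i j k} → Palette i j k → ∀ v z →
    𝟙 (v ≟ z) + (e v z i + (e v z j + e v z k)) ≡ 1
  e-total {i} {j} {k} ijk v z with v ≟ z
  ... | yes _ = refl
  ... | no  _ with ijk | palette-complete i j k ijk (color f v z)
  ...   | i≢j , i≢k , _ | inj₁ refl
    rewrite 𝟙-yes (color f v z ≟ i) refl | 𝟙-no (i ≟ j) i≢j | 𝟙-no (i ≟ k) i≢k = refl
  ...   | i≢j , _ , j≢k | inj₂ (inj₁ refl)
    rewrite 𝟙-yes (j ≟ j) refl | 𝟙-no (j ≟ i) (i≢j ∘ sym) | 𝟙-no (j ≟ k) j≢k = refl
  ...   | _ , i≢k , j≢k | inj₂ (inj₂ refl)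
    rewrite 𝟙-yes (k ≟ k) refl | 𝟙-no (k ≟ i) (i≢k ∘ sym) | 𝟙-no (k ≟ j) (j≢k ∘ sym) = refl

  opaque
    unfolding deg codeg

    deg-total : ∀ {i j k} → Palette i j k → ∀ v → 1 + (deg v i + (deg v j + deg v k)) ≡ p
    deg-total {i} {j} {k} ijk v = begin
      1 + (deg v i + (deg v j + deg v k))
        ≡⟨ cong₂ _+_ (sum-δ (λ _ → 1) v)
             (∑-distrib-+₃ (λ z → e v z i) (λ z → e v z j) (λ z → e v z k)) ⟨
      sum (λ z → 1 * 𝟙 (v ≟ z)) + sum (λ z → e v z i + (e v z j + e v z k))
        ≡⟨ ∑-distrib-+ (λ z → 1 * 𝟙 (v ≟ z)) (λ z → e v z i + (e v z j + e v z k)) ⟨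
      sum (λ z → 1 * 𝟙 (v ≟ z) + (e v z i + (e v z j + e v z k)))
        ≡⟨ sum-cong-≗ (λ z → trans (cong (_+ (e v z i + (e v z j + e v z k))) (*-identityˡ (𝟙 (v ≟ z)))) (e-total ijk v z)) ⟩
      sum {p} (λ _ → 1)
        ≡⟨ sum-ones p ⟩
      p ∎
      where open ≡-Reasoning

    -- This is `e-total` at `x`, weighted by `e v z c` and summed; the diagonal term survives only
    -- at `z = x`.
    deg-split : ∀ {i j k} → Palette i j k → ∀ v x c →
      deg v c ≡ e v x c + (codeg v x c i + (codeg v x c j + codeg v x c k))
    deg-split {i} {j} {k} ijk v x c = begin
      sum (λ z → e v z c)
        ≡⟨ sum-cong-≗ (λ z → trans (sym (*-identityʳ (e v z c))) (trans (cong (e v z c *_) (sym (e-total ijk x z)))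
             (distrib (e v z c) (𝟙 (x ≟ z)) (e x z i) (e x z j) (e x z k)))) ⟩
      sum (λ z → e v z c * 𝟙 (x ≟ z) + (ee v x c i z + (ee v x c j z + ee v x c k z)))
        ≡⟨ ∑-distrib-+ (λ z → e v z c * 𝟙 (x ≟ z)) (λ z → ee v x c i z + (ee v x c j z + ee v x c k z)) ⟩
      sum (λ z → e v z c * 𝟙 (x ≟ z)) + sum (λ z → ee v x c i z + (ee v x c j z + ee v x c k z))
        ≡⟨ cong₂ _+_ (sum-δ (λ z → e v z c) x) (∑-distrib-+₃ (ee v x c i) (ee v x c j) (ee v x c k)) ⟩
      e v x c + (codeg v x c i + (codeg v x c j + codeg v x c k)) ∎
      where
      open ≡-Reasoning
      distrib : ∀ a d b₁ b₂ b₃ → a * (d + (b₁ + (b₂ + b₃))) ≡ a * d + (a * b₁ + (a * b₂ + a * b₃))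
      distrib = solve-∀

    codeg-witness : ∀ {v x c c′} → 0 < codeg v x c c′ →
      ∃[ z ] (v ≢ z × color f v z ≡ c) × (x ≢ z × color f x z ≡ c′)
    codeg-witness {v} {x} {c} {c′} q
      with z , q′ ← sum-pos _ q
      with v~z , x~z ← *-pos (e v z c) (e x z c′) q′
      = z , 𝟙-pos (hasColor? v z c) v~z , 𝟙-pos (hasColor? x z c′) x~z

  deg-same : ∀ {i j k v x} → Palette i j k → v ≢ x → color f v x ≡ i →
    deg v i ≡ 1 + (codeg v x i i + (codeg v x i j + codeg v x i k))
  deg-same {i} {j} {k} {v} {x} ijk v≢x vx=i =
    trans (deg-split ijk v x i) (cong (_+ (codeg v x i i + (codeg v x i j + codeg v x i k)))
      (𝟙-yes (hasColor? v x i) (v≢x , vx=i)))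

  -- In `deg-split` two terms vanish: `e v x j` because `vx` has color `i`, and `codeg v x j k`
  -- because any `z` it counts would make `vxz` rainbow.
  deg-other : ∀ {i j k v x} → Palette i j k → v ≢ x → color f v x ≡ i →
    deg v j ≡ codeg v x j i + codeg v x j j
  deg-other {i} {j} {k} {v} {x} ijk@(i≢j , _) v≢x vx=i = begin
    deg v j
      ≡⟨ deg-split ijk v x j ⟩
    e v x j + (codeg v x j i + (codeg v x j j + codeg v x j k))
      ≡⟨ cong₂ _+_ (𝟙-no (hasColor? v x j) λ (_ , vx=j) → i≢j (trans (sym vx=i) vx=j))
           (cong (λ n → codeg v x j i + (codeg v x j j + n)) (n≤0⇒n≡0 (≮⇒≥ rainbow))) ⟩
    codeg v x j i + (codeg v x j j + 0)
      ≡⟨ cong (codeg v x j i +_) (+-identityʳ _) ⟩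
    codeg v x j i + codeg v x j j ∎
    where
    open ≡-Reasoning
    rainbow : ¬ 0 < codeg v x j k
    rainbow q with z , (v≢z , vz=j) , (x≢z , xz=k) ← codeg-witness {v} {x} q =
      noRainbow ijk v≢x v≢z x≢z vx=i vz=j xz=k

  opaque
    unfolding deg codeg

    -- For each `z` the four products factor as `(e v z i + e v z j) * (e x z i + e x z j)`. Each
    -- factor is at most 1, and both are positive only at a page.
    codeg≤pages : ∀ {i j k} → Palette i j k → ∀ v x →
      (codeg v x i i + codeg v x i j) + (codeg v x j i + codeg v x j j) ≤ pages f k v x
    codeg≤pages {i} {j} {k} ijk@(_ , i≢k , j≢k) v x = begin
      (codeg v x i i + codeg v x i j) + (codeg v x j i + codeg v x j j)
        ≡⟨ cong₂ _+_ (∑-distrib-+ (ee v x i i) (ee v x i j)) (∑-distrib-+ (ee v x j i) (ee v x j j)) ⟨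
      sum (λ z → ee v x i i z + ee v x i j z) + sum (λ z → ee v x j i z + ee v x j j z)
        ≡⟨ ∑-distrib-+ (λ z → ee v x i i z + ee v x i j z) (λ z → ee v x j i z + ee v x j j z) ⟨
      sum (λ z → (ee v x i i z + ee v x i j z) + (ee v x j i z + ee v x j j z))
        ≡⟨ sum-cong-≗ (λ z → factor (e v z i) (e v z j) (e x z i) (e x z j)) ⟩
      sum (λ z → (e v z i + e v z j) * (e x z i + e x z j))
        ≤⟨ sum-mono-≤ (λ z → ≤𝟙 (page? f k v x z) (*-mono-≤ (ij≤1 v z) (ij≤1 x z)) (isPage z)) ⟩
      pages f k v x ∎
      where
      open ≤-Reasoning
      factor : ∀ a b c d → (a * c + a * d) + (b * c + b * d) ≡ (a + b) * (c + d)
      factor = solve-∀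

      ij≤1 : ∀ u z → e u z i + e u z j ≤ 1
      ij≤1 u z = begin
        e u z i + e u z j                               ≤⟨ +-monoʳ-≤ (e u z i) (m≤m+n (e u z j) (e u z k)) ⟩
        e u z i + (e u z j + e u z k)                   ≤⟨ m≤n+m _ (𝟙 (u ≟ z)) ⟩
        𝟙 (u ≟ z) + (e u z i + (e u z j + e u z k))     ≡⟨ e-total ijk u z ⟩
        1                                               ∎

      avoids : ∀ u z → 0 < e u z i + e u z j → u ≢ z × color f u z ≢ k
      avoids u z q with +-pos (e u z i) q
      ... | inj₁ q′ with u≢z , refl ← 𝟙-pos (hasColor? u z i) q′ = u≢z , i≢k
      ... | inj₂ q′ with u≢z , refl ← 𝟙-pos (hasColor? u z j) q′ = u≢z , j≢k

      isPage : ∀ z → 0 < (e v z i + e v z j) * (e x z i + e x z j) → Page f k v x z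
      isPage z q
        with v~z , x~z ← *-pos (e v z i + e v z j) (e x z i + e x z j) q
        with v≢z , vz≢k ← avoids v z v~z | x≢z , xz≢k ← avoids x z x~z
        = v≢z , x≢z , vz≢k , xz≢k

  opaque
    unfolding codeg

    -- Every z joined to v in color j and to y in color k is joined to x in
    -- color i, and so is y itself.
    codeg-mono : ∀ {i j k v x y} → Palette i j k → v ≢ x → v ≢ y → x ≢ y →
      color f v x ≡ i → color f v y ≡ j → color f x y ≡ i →
      1 + codeg v y j k ≤ codeg v x j i
    codeg-mono {i} {j} {k} {v} {x} {y} ijk@(i≢j , i≢k , j≢k) v≢x v≢y x≢y vx=i vy=j xy=i = begin
      1 + codeg v y j k
        -- The 1 stands for `y` itself; written as a sum, it allows a comparison term by term.
        ≡⟨ cong (_+ codeg v y j k) (trans (sum-δ (λ z → e v z j) y) (𝟙-yes (hasColor? v y j) (v≢y , vy=j))) ⟨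
      sum (λ z → e v z j * 𝟙 (y ≟ z)) + codeg v y j k
        ≡⟨ ∑-distrib-+ (λ z → e v z j * 𝟙 (y ≟ z)) (ee v y j k) ⟨
      sum (λ z → e v z j * 𝟙 (y ≟ z) + e v z j * e y z k)
        ≤⟨ sum-mono-≤ pointwise ⟩
      codeg v x j i ∎
      where
      open ≤-Reasoning
      xz=i : ∀ z → v ≢ z × color f v z ≡ j → 0 < 𝟙 (y ≟ z) + e y z k → x ≢ z × color f x z ≡ i
      xz=i z (v≢z , vz=j) q with +-pos (𝟙 (y ≟ z)) q
      ... | inj₁ q′ with refl ← 𝟙-pos (y ≟ z) q′ = x≢y , xy=i
      ... | inj₂ q′ with y≢z , yz=k ← 𝟙-pos (hasColor? y z k) q′ =
        x≢z , color-xz (palette-complete i j k ijk (color f x z))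
        where
        x≢z : x ≢ z
        x≢z refl = i≢j (trans (sym vx=i) vz=j)
        -- Color `j` on `xz` would make `xyz` rainbow, color `k` would make `vxz` rainbow.
        color-xz : color f x z ≡ i ⊎ color f x z ≡ j ⊎ color f x z ≡ k → color f x z ≡ i
        color-xz (inj₁ xz=i) = xz=i
        color-xz (inj₂ (inj₁ xz=j)) = contradiction yz=k (noRainbow ijk x≢y x≢z y≢z xy=i xz=j)
        color-xz (inj₂ (inj₂ xz=k)) = contradiction xz=k (noRainbow ijk v≢x v≢z x≢z vx=i vz=j)

      ≤1 : ∀ z → 𝟙 (y ≟ z) + e y z k ≤ 1
      ≤1 z = begin
        𝟙 (y ≟ z) + e y z k
          ≤⟨ +-monoʳ-≤ (𝟙 (y ≟ z)) (m≤m+n (e y z k) (e y z i + e y z j)) ⟩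
        𝟙 (y ≟ z) + (e y z k + (e y z i + e y z j))
          ≡⟨ e-total (i≢k ∘ sym , j≢k ∘ sym , i≢j) y z ⟩
        1 ∎

      pointwise : ∀ z → e v z j * 𝟙 (y ≟ z) + e v z j * e y z k ≤ e v z j * e x z i
      pointwise z = begin
        e v z j * 𝟙 (y ≟ z) + e v z j * e y z k
          ≡⟨ *-distribˡ-+ (e v z j) (𝟙 (y ≟ z)) (e y z k) ⟨
        e v z j * (𝟙 (y ≟ z) + e y z k)
          ≤⟨ 𝟙-*-monoʳ-≤ (hasColor? v z j) (λ vz=j → ≤𝟙 (hasColor? x z i) (≤1 z) (xz=i z vz=j)) ⟩
        e v z j * e x z i ∎

-- Upper bound: Gallai colorings of order 11 with at most five pages everywhere.

module Thin (f : Coloring 3 11) (gallai : Gallai f)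
  (thin : ∀ c x y → x ≢ y → color f x y ≢ c → pages f c x y ≤ 5) where

  open ColorDegrees f gallai

  deg-total-10 : ∀ {i j k} → Palette i j k → ∀ v → deg v i + (deg v j + deg v k) ≡ 10
  deg-total-10 ijk v = cong pred (deg-total ijk v)

  -- When both degrees are expanded over `x`, everything except the edge `vx` and `codeg v x i k`
  -- counts pages of `vx` avoiding `k`. There are at most 5 of these, and the edge adds 1.
  deg+deg≤6+codeg : ∀ {i j k v x} → Palette i j k → v ≢ x → color f v x ≡ i →
    deg v i + deg v j ≤ 6 + codeg v x i k
  deg+deg≤6+codeg {i} {j} {k} {v} {x} ijk@(_ , i≢k , _) v≢x vx=i = begin
    deg v i + deg v j
      ≡⟨ cong₂ _+_ (deg-same ijk v≢x vx=i) (deg-other ijk v≢x vx=i) ⟩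
    1 + (codeg v x i i + (codeg v x i j + codeg v x i k)) + (codeg v x j i + codeg v x j j)
      ≡⟨ rearrange (codeg v x i i) (codeg v x i j) (codeg v x i k) (codeg v x j i) (codeg v x j j) ⟩
    1 + ((codeg v x i i + codeg v x i j) + (codeg v x j i + codeg v x j j)) + codeg v x i k
      ≤⟨ +-monoˡ-≤ (codeg v x i k) (s≤s (≤-trans (codeg≤pages ijk v x)
           (thin k v x v≢x (λ vx=k → i≢k (trans (sym vx=i) vx=k))))) ⟩
    6 + codeg v x i k ∎
    where
    open ≤-Reasoning
    rearrange : ∀ a b c d e → 1 + (a + (b + c)) + (d + e) ≡ 1 + ((a + b) + (d + e)) + c
    rearrange = solve-∀

  -- The bound `deg+deg≤6+codeg` for the edge `vy`, with `i` and `j` exchanged, has excess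
  -- `codeg v y j k`; `codeg-mono` trades it for `codeg v x j i` and gains 1.
  deg+deg≤5+codeg : ∀ {i j k v x y} → Palette i j k → v ≢ x → v ≢ y → x ≢ y →
    color f v x ≡ i → color f v y ≡ j → color f x y ≡ i →
    deg v i + deg v j ≤ 5 + codeg v x j i
  deg+deg≤5+codeg {i} {j} {k} {v} {x} {y} ijk@(i≢j , i≢k , j≢k) v≢x v≢y x≢y vx=i vy=j xy=i = begin
    deg v i + deg v j            ≡⟨ +-comm (deg v i) (deg v j) ⟩
    deg v j + deg v i            ≤⟨ deg+deg≤6+codeg (i≢j ∘ sym , j≢k , i≢k) v≢y vy=j ⟩
    6 + codeg v y j k            ≡⟨ +-suc 5 (codeg v y j k) ⟨
    5 + (1 + codeg v y j k)      ≤⟨ +-monoʳ-≤ 5 (codeg-mono ijk v≢x v≢y x≢y vx=i vy=j xy=i) ⟩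
    5 + codeg v x j i            ∎
    where open ≤-Reasoning

  -- If deg v k ≤ 3 then some w has vw of color i and xw of color k, and
  -- adding up the bounds on degrees at v and, via w, at x gives
  -- deg v i + deg v j + deg v k ≤ 9.
  isosceles⇒deg≥4 : ∀ {i j k v x y} → Palette i j k → v ≢ x → v ≢ y → x ≢ y →
    color f v x ≡ i → color f v y ≡ j → color f x y ≡ i → 4 ≤ deg v k
  isosceles⇒deg≥4 {i} {j} {k} {v} {x} {y} ijk@(i≢j , i≢k , j≢k) v≢x v≢y x≢y vx=i vy=j xy=i =
    ≮⇒≥ λ deg<4 → small (s≤s⁻¹ deg<4)
    where
    open ≤-Reasoning
    xv=i : color f x v ≡ i
    xv=i = trans (color-sym f x v) vx=i

    total : deg v i + deg v j + deg v k ≡ 10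
    total = trans (+-assoc (deg v i) (deg v j) (deg v k)) (deg-total-10 ijk v)

    small : ¬ deg v k ≤ 3
    small deg≤3 with codeg-witness {v} {x} {i} {k} (+-cancelˡ-≤ 9 _ _ (begin
        10                               ≡⟨ total ⟨
        deg v i + deg v j + deg v k      ≤⟨ +-mono-≤ (deg+deg≤6+codeg ijk v≢x vx=i) deg≤3 ⟩
        6 + codeg v x i k + 3            ≡⟨ +-comm _ 3 ⟩
        9 + codeg v x i k                ∎))
    ... | w , (v≢w , vw=i) , (x≢w , xw=k) = <-irrefl total (begin-strict
        deg v i + deg v j + deg v k
          ≤⟨ +-monoˡ-≤ (deg v k) (deg+deg≤5+codeg ijk v≢x v≢y x≢y vx=i vy=j xy=i) ⟩
        5 + codeg v x j i + deg v k
          ≤⟨ +-monoʳ-≤ 5 codeg+deg≤4 ⟩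
        9
          <⟨ ≤-refl ⟩
        10 ∎)
      where
      ikj : Palette i k j
      ikj = i≢k , i≢j , j≢k ∘ sym

      -- The triangle `xvw` has the same shape with apex `x`, and with `k` in the role of `j`.
      degsAtX : deg x i + deg x k ≤ 5 + codeg x v k i
      degsAtX = deg+deg≤5+codeg ikj (v≢x ∘ sym) x≢w v≢w xv=i xw=k vw=i

      rearrange : ∀ a b s q u → a + ((1 + q) + (s + (b + u))) ≡ 1 + (a + (b + s)) + (q + u)
      rearrange = solve-∀

      -- Expanding the degrees in `degsAtX` and cancelling `1 + codeg x v k i` leaves four codegrees
      -- with sum at most 4. Three of them make up the left side here; `codeg x v i i` is dropped.
      codeg+deg≤4 : codeg v x j i + deg v k ≤ 4
      codeg+deg≤4 = begin
        codeg v x j i + deg v k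
          ≡⟨ cong₂ _+_ (codeg-comm v x j i) (trans (deg-other ikj v≢x vx=i)
               (cong₂ _+_ (codeg-comm v x k i) (codeg-comm v x k k))) ⟩
        codeg x v i j + (codeg x v i k + codeg x v k k)
          ≤⟨ +-cancelˡ-≤ (1 + codeg x v k i) _ _ (begin
            (1 + codeg x v k i) + (codeg x v i j + (codeg x v i k + codeg x v k k))
              ≤⟨ m≤n+m _ (codeg x v i i) ⟩
            codeg x v i i + ((1 + codeg x v k i) + (codeg x v i j + (codeg x v i k + codeg x v k k)))
              ≡⟨ rearrange (codeg x v i i) (codeg x v i k) (codeg x v i j) (codeg x v k i) (codeg x v k k) ⟩
            1 + (codeg x v i i + (codeg x v i k + codeg x v i j)) + (codeg x v k i + codeg x v k k)
              ≡⟨ cong₂ _+_ (deg-same ikj (v≢x ∘ sym) xv=i) (deg-other ikj (v≢x ∘ sym) xv=i) ⟨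
            deg x i + deg x k
              ≤⟨ degsAtX ⟩
            5 + codeg x v k i
              ≡⟨ cong suc (+-comm 4 (codeg x v k i)) ⟩
            (1 + codeg x v k i) + 4 ∎) ⟩
        4 ∎

  -- The edge `xy` cannot have color `k`, as `vxy` would be rainbow. So the triangle is isosceles,
  -- with `x` and `y` as well as `i` and `j` exchanged if `xy` has color `j`.
  bichromatic⇒deg≥4 : ∀ {i j k v x y} → Palette i j k → v ≢ x → v ≢ y →
    color f v x ≡ i → color f v y ≡ j → 4 ≤ deg v k
  bichromatic⇒deg≥4 {i} {j} {k} {v} {x} {y} ijk@(i≢j , i≢k , j≢k) v≢x v≢y vx=i vy=j =
    cases (palette-complete i j k ijk (color f x y))
    where
    x≢y : x ≢ y
    x≢y refl = i≢j (trans (sym vx=i) vy=j)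
    cases : color f x y ≡ i ⊎ color f x y ≡ j ⊎ color f x y ≡ k → 4 ≤ deg v k
    cases (inj₁ xy=i) = isosceles⇒deg≥4 ijk v≢x v≢y x≢y vx=i vy=j xy=i
    cases (inj₂ (inj₁ xy=j)) = isosceles⇒deg≥4 (i≢j ∘ sym , j≢k , i≢k) v≢y v≢x (x≢y ∘ sym)
      vy=j vx=i (trans (color-sym f y x) xy=j)
    cases (inj₂ (inj₂ xy=k)) = contradiction xy=k (noRainbow ijk v≢x v≢y x≢y vx=i vy=j)

  monochromaticStars : ∀ {v x y} → v ≢ x → v ≢ y → color f v x ≡ color f v y
  monochromaticStars {v} {x} {y} v≢x v≢y with color f v x ≟ color f v y
  ... | yes eq = eq
  ... | no i≢j with thirdColor _ _ i≢j
  ...   | k , ijk@(_ , i≢k , j≢k)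
    with deg-k ← bichromatic⇒deg≥4 ijk v≢x v≢y refl refl
    -- Color `k` now occurs at `v` too, so each of the other two colors is in turn the third one for
    -- a pair of edges at `v`.
    with z , v≢z , vz=k ← deg-witness (≤-trans (s≤s z≤n) deg-k)
    = contradiction (begin
        12                                            ≤⟨ +-mono-≤ deg-i (+-mono-≤ deg-j deg-k) ⟩
        deg v _ + (deg v _ + deg v k)                 ≡⟨ deg-total-10 ijk v ⟩
        10                                            ∎) (<⇒≱ (from-yes (10 <? 12)))
    where
    open ≤-Reasoning
    deg-i : 4 ≤ deg v (color f v x)
    deg-i = bichromatic⇒deg≥4 (j≢k , i≢j ∘ sym , i≢k ∘ sym) v≢y v≢z refl vz=k
    deg-j : 4 ≤ deg v (color f v y)
    deg-j = bichromatic⇒deg≥4 (i≢k , i≢j , j≢k ∘ sym) v≢x v≢z refl vz=k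

  -- All edges at `v` and at `x` share the color `i` of `vx`. Hence `deg v k` and `codeg v x i k`
  -- vanish, and `deg+deg≤6+codeg` bounds the total degree 10 by 6.
  at-most-one-vertex : ∀ v x → ¬ v ≢ x
  at-most-one-vertex v x v≢x with otherColor (color f v x)
  ... | j , i≢j with thirdColor _ j i≢j
  ...   | k , ijk@(_ , i≢k , _) = <⇒≱ (from-yes (6 <? 10)) (begin
    10
      ≡⟨ deg-total-10 ijk v ⟨
    deg v i + (deg v j + deg v k)
      ≡⟨ +-assoc (deg v i) _ _ ⟨
    deg v i + deg v j + deg v k
      ≤⟨ +-mono-≤ (deg+deg≤6+codeg ijk v≢x refl) (≮⇒≥ no-k) ⟩
    6 + codeg v x i k + 0
      ≤⟨ +-monoˡ-≤ 0 (+-monoʳ-≤ 6 (≮⇒≥ no-ik)) ⟩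
    6 ∎)
    where
    open ≤-Reasoning
    i = color f v x
    no-k : ¬ 0 < deg v k
    no-k q with z , v≢z , vz=k ← deg-witness q =
      i≢k (trans (monochromaticStars v≢x v≢z) vz=k)
    no-ik : ¬ 0 < codeg v x i k
    no-ik q with w , _ , x≢w , xw=k ← codeg-witness {v} {x} q =
      i≢k (trans (color-sym f v x) (trans (monochromaticStars (v≢x ∘ sym) x≢w) xw=k))

forces-11 : Forces 3 2 (B 6) 11
forces-11 f gallai =
  [ id , (λ thin → ⊥-elim (Thin.at-most-one-vertex f gallai thin 0F 1F λ ())) ]′ (book-or-thin f 5)

-- Lower bound: two blocks of two pentagons.

-- A coloring of `K q` restricts to `K p`, and a copy found there survives in `K q`. One bad
-- coloring of order 10 therefore excludes every smaller order as well.
forces-mono : ∀ {t s G p q} → p ≤ q → Forces t s G p → Forces t s G q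
forces-mono {t} {s} {G} {p} {q} p≤q forces f gallai = extend (forces restriction restriction-gallai)
  where
  ι : Fin p → Fin q
  ι x = inject≤ x p≤q

  ι-inj : ∀ {x y} → ι x ≡ ι y → x ≡ y
  ι-inj = inject≤-injective p≤q p≤q _ _

  restriction : Coloring t p
  restriction = record
    { color     = λ x y → color f (ι x) (ι y)
    ; color-sym = λ x y → color-sym f (ι x) (ι y)
    }

  restriction-gallai : Gallai restriction
  restriction-gallai (x , y , z , (x≢y , x≢z , y≢z) , rainbow) =
    gallai (ι x , ι y , ι z , (x≢y ∘ ι-inj , x≢z ∘ ι-inj , y≢z ∘ ι-inj) , rainbow)

  extend : Σ[ φ ∈ Copy G (K p) ] UsesAtMost s restriction φ → Σ[ φ ∈ Copy G (K q) ] UsesAtMost s f φ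
  extend (φ , few) = record
    { embed     = ι ∘ embed φ
    ; injective = injective φ ∘ ι-inj
    ; preserves = λ uv → preserves φ uv ∘ ι-inj
    } , few

-- Differences 1 and 4 are the steps by one modulo 5, so color 0 is a 5-cycle and color 1 is the
-- complementary 5-cycle. The last clause also takes the junk diagonal.
pentagons : Fin 5 → Fin 5 → Fin 3
pentagons a b with ∣ toℕ a - toℕ b ∣
... | 1 = 0F
... | 4 = 0F
... | _ = 1F

twoPentagons : Coloring 3 10
twoPentagons = record
  { color     = c
  ; color-sym = from-yes (all? λ x → all? λ y → c x y ≟ c y x)
  }
  where
  c : Fin 10 → Fin 10 → Fin 3
  -- Here `q` and `r` are the blocks, `a` and `b` the positions within them.
  c x y with remQuot {2} 5 x | remQuot {2} 5 y
  ... | q , a | r , b = if does (q ≟ r) then pentagons a b else 2F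

-- Checked over all triples. The reason: a triangle inside a block sees only colors 0 and 1, and any
-- other has two edges of color 2.
twoPentagons-gallai : Gallai twoPentagons
twoPentagons-gallai (x , y , z , distinct , rainbow) = noRainbow x y z distinct rainbow
  where
  c = color twoPentagons
  noRainbow : ∀ x y z → x ≢ y × x ≢ z × y ≢ z →
    ¬ (c x y ≢ c x z × c x y ≢ c y z × c x z ≢ c y z)
  noRainbow = from-yes (all? {n = 10} λ x → all? λ y → all? λ z →
    (¬? (x ≟ y) ×-dec ¬? (x ≟ z) ×-dec ¬? (y ≟ z)) →-dec
    ¬? (¬? (c x y ≟ c x z) ×-dec ¬? (c x y ≟ c y z) ×-dec ¬? (c x z ≟ c y z)))

-- Checked exhaustively. If `c` is 0 or 1, an edge inside a block has as pages the 5 vertices of the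
-- other block and none of its own, a pentagon being triangle-free; an edge between blocks has 2
-- pages in each. If `c` is 2, only the 3 remaining vertices of the block are pages.
twoPentagons-thin : ∀ c x y → x ≢ y → color twoPentagons x y ≢ c → pages twoPentagons c x y < 6
twoPentagons-thin = from-yes (all? {n = 3} λ c → all? {n = 10} λ x → all? λ y →
  ¬? (x ≟ y) →-dec ¬? (color twoPentagons x y ≟ c) →-dec (pages twoPentagons c x y <? 6))

thin⇒¬forces : ∀ {p} n (f : Coloring 3 p) → Gallai f →
  (∀ c x y → x ≢ y → color f x y ≢ c → pages f c x y < n) → ¬ Forces 3 2 (B n) p
thin⇒¬forces n f gallai thin forces
  with φ , few ← forces f gallai
  with c , x , y , x≢y , xy≢c , thick ← book⇒pages f φ few
  = <⇒≱ (thin c x y x≢y xy≢c) thick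

theorem4p2 : IsWeakenedGallaiRamsey 3 2 (B 6) 11
theorem4p2 = forces-11 , λ q forces → ≰⇒> λ q≤10 →
  thin⇒¬forces 6 twoPentagons twoPentagons-gallai twoPentagons-thin
    (forces-mono {G = B 6} q≤10 forces)
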